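{- Let $\mathcal{L}$ be a monochromatic graphical language with underlying prop $\mathbf{L}$. Given a monochromatic prop $\mathbf{C}$ and an interpretation $\llbracket\_\rrbracket:\mathbf{L}\to\mathbf{C}$, let $\mathbf{C}_p$ be the symmetric strict monoidal category whose objects are the pairs $(n,p_n)$ where $p_n$ is a partition of $n$, and such that $\mathbf{C}_p[(n,p_n),(m,p_m)]=\mathbf{C}[n,m]$. Then $\mathbf{C}_p$ is an $\mathbb{N}_{>0}$-colored prop, and there is a unique $\mathbb{N}_{>0}$-colored prop morphism $\llbracket\_\rrbracket_p:\mathcal{S}\mathbf{L}\to\mathbf{C}_p$ such that $[\_]\circ\llbracket\_\rrbracket_p=\llbracket\_\rrbracket\circ\{\_\}$, where $[\_]:\mathbf{C}_p\to\mathbf{C}$ is the functor forgetting the partition and $\{\_\}:\mathcal{S}\mathbf{L}\to\mathbf{L}$ is the wire stripper functor. This morphism $\llbracket\_\rrbracket_p$ is called the scaled interpretation, and it is faithful if and only if $\llbracket\_\rrbracket$ is faithful.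
   Context: Props. For a set $C$ of colors, $C^*$ is the set of finite lists of elements of $C$, $\boxtimes$ is concatenation and $0$ the empty list. A $C$-colored prop is a small symmetric strict monoidal category whose monoid of objects is $(C^*,\boxtimes,0)$; a $C$-colored prop morphism is an identity-on-objects symmetric strict monoidal functor. A $C$-colored signature $\Sigma$ is a family of sets $\Sigma[\mathbf{a},\mathbf{b}]$ ($\mathbf{a},\mathbf{b}\in C^*$) of generators of type $\mathbf{a}\to\mathbf{b}$; $F(\Sigma)$ is the free $C$-colored prop on $\Sigma$, and its morphisms are called diagrams. A $C$-colored graphical language $\mathcal{L}$ is a signature $\Sigma_\mathcal{L}$ together with a family of equations (pairs of parallel diagrams in $F(\Sigma_\mathcal{L})$); its underlying prop $\mathbf{L}$ is the quotient of $F(\Sigma_\mathcal{L})$ by the smallest prop congruence containing the equations, with quotient morphism $\pi_\mathcal{L}:F(\Sigma_\mathcal{L})\to\mathbf{L}$. Monochromatic means $C$ is a singleton; then objects are the natural numbers (lengths of lists). Interpretations. An interpretation of a graphical language $\mathcal{L}$ is a functor from its underlying prop $\mathbf{L}$ to a category $\mathbf{C}$, where "functor" means a symmetric monoidal functor between small symmetric monoidal categories, which in general need not be a prop morphism. Sizes. Colors are now the positive integers $\mathbb{N}_{>0}$. The list consisting of $k$ copies of $n$ is denoted $k\cdot n$; so $1\cdot n$ is the one-element list $\langle n\rangle$ and $k\cdot 1$ is the list of $k$ ones; by convention $0\cdot n=k\cdot 0=0$. The global size of $\mathbf{a}=\langle n_1,\dots,n_k\rangle$ is $[\mathbf{a}]=n_1+\dots+n_k$.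 Scalable construction. Let $\mathcal{L}$ be a monochromatic graphical language. $\mathcal{SL}$ is the $\mathbb{N}_{>0}$-colored graphical language whose generators are: for each $n\ge 1$, a divider $\delta_n:1\cdot(n+1)\to(1\cdot 1)\boxtimes(1\cdot n)$ and a gatherer $\gamma_n:(1\cdot 1)\boxtimes(1\cdot n)\to 1\cdot(n+1)$; and each generator $x\in\Sigma_\mathcal{L}[n,m]$, regarded as having type $n\cdot 1\to m\cdot 1$. Its equations are $\gamma_n\circ\delta_n=\mathrm{id}_{1\cdot(n+1)}$ and $\delta_n\circ\gamma_n=\mathrm{id}_{1\cdot 1}\boxtimes\mathrm{id}_{1\cdot n}$ for all $n\ge1$, together with the equations of $\mathcal{L}$ (read on wires of size 1). Its underlying prop is denoted $\mathcal{S}\mathbf{L}$. Wire stripper. $\{\_\}:\mathcal{S}\mathbf{L}\to\mathbf{L}$ is the symmetric strict monoidal functor with $\{\mathbf{a}\}=[\mathbf{a}]$ on objects, $\{\pi_\mathcal{SL}(\delta_k)\}=\{\pi_\mathcal{SL}(\gamma_k)\}=\mathrm{id}_{k+1}$, and $\{\pi_\mathcal{SL}(x)\}=\pi_\mathcal{L}(x)$ for $x\in\Sigma_\mathcal{L}$. The category $\mathbf{C}_p$. A partition of $n$ is here an ordered one, i.e. a finite list of positive integers with sum $n$, so objects $(n,p_n)$ correspond to elements of $(\mathbb{N}_{>0})^*$. Composition, tensor of morphisms and symmetries are those of $\mathbf{C}$, and the tensor of objects is $(n,p)\boxtimes(m,q)=(n+m,p\boxtimes q)$. The functor $[\_]:\mathbf{C}_p\to\mathbf{C}$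 sends $(n,p_n)$ to $n$ and is the identity on hom-sets.
   Formalization: The interpretation is taken to be a prop morphism (identity on objects, strict, symmetric) instead of an arbitrary symmetric monoidal functor; otherwise no such scaled interpretation exists, e.g. for the functor doubling wires, n ↦ 2n. -}

module Defs where

open import Algebra.Bundles using (RawMonoid)
open import Algebra.Morphism.Structures using (module MonoidMorphisms)
import Algebra.Morphism.Construct.Identity as Identity
open import Algebra.Structures using (IsMonoid)
open import Data.Empty using (⊥)
open import Data.List.Base using (List; []; _∷_; _++_; map; replicate)
open import Data.List.Properties using (++-isMonoid; map-++)
open import Data.Nat.Base using (ℕ; zero; suc; _+_; NonZero)
open import Data.Nat.ListAction using (sum)
open import Data.Nat.ListAction.Properties using (sum-++)
open import Data.Nat.Properties using (+-0-isMonoid)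
open import Function.Base using (_∘′_)
open import Level using (0ℓ)
open import Relation.Binary.Core using (Rel)
open import Relation.Binary.PropositionalEquality
  using (_≡_; refl; sym; trans; cong; subst₂)
open import Relation.Binary.Structures using (IsEquivalence)

-- Strictness refers to equality of objects, so these are monoids for _≡_.

record ObjectMonoid : Set₁ where
  infixr 6 _∙_
  field
    Carrier  : Set
    _∙_      : Carrier → Carrier → Carrier
    ε        : Carrier
    isMonoid : IsMonoid _≡_ _∙_ ε

  assoc : ∀ a b c → (a ∙ b) ∙ c ≡ a ∙ (b ∙ c)
  assoc = IsMonoid.assoc isMonoid

  identityˡ : ∀ a → ε ∙ a ≡ a
  identityˡ = IsMonoid.identityˡ isMonoid

  identityʳ : ∀ a → a ∙ ε ≡ a
  identityʳ = IsMonoid.identityʳ isMonoid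

  rawMonoid : RawMonoid 0ℓ 0ℓ
  rawMonoid = record { Carrier = Carrier ; _≈_ = _≡_ ; _∙_ = _∙_ ; ε = ε }

open ObjectMonoid using (Carrier; rawMonoid)

_* : Set → ObjectMonoid
C * = record { Carrier = List C ; _∙_ = _++_ ; ε = [] ; isMonoid = ++-isMonoid }

-- The free monoid on one color, lists being represented by their lengths.

ℕ-monoid : ObjectMonoid
ℕ-monoid = record { Carrier = ℕ ; _∙_ = _+_ ; ε = 0 ; isMonoid = +-0-isMonoid }

IsMonoidHom : (M N : ObjectMonoid) → (Carrier M → Carrier N) → Set
IsMonoidHom M N =
  MonoidMorphisms.IsMonoidHomomorphism (rawMonoid M) (rawMonoid N)

module _ {M N : ObjectMonoid} {φ : Carrier M → Carrier N}
         (φ-hom : IsMonoidHom M N φ) where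
  private
    module M = ObjectMonoid M
    module N = ObjectMonoid N

  homo : ∀ a b → φ (a M.∙ b) ≡ φ a N.∙ φ b
  homo = MonoidMorphisms.IsMonoidHomomorphism.homo φ-hom

  ε-homo : φ M.ε ≡ N.ε
  ε-homo = MonoidMorphisms.IsMonoidHomomorphism.ε-homo φ-hom

id-isMonoidHom : (M : ObjectMonoid) → IsMonoidHom M M (λ a → a)
id-isMonoidHom M = Identity.isMonoidHomomorphism (rawMonoid M) refl

record RawSSMC (M : ObjectMonoid) : Set₁ where
  open ObjectMonoid M using (_∙_) renaming (Carrier to Ob)
  infix  4 _≈_
  infixr 9 _∘_
  infixr 7 _⊠_
  field
    Hom : Ob → Ob → Set
    _≈_ : ∀ {a b} → Rel (Hom a b) 0ℓ
    id  : ∀ {a} → Hom a a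
    _∘_ : ∀ {a b c} → Hom b c → Hom a b → Hom a c
    _⊠_ : ∀ {a b c d} → Hom a b → Hom c d → Hom (a ∙ c) (b ∙ d)
    σ   : ∀ a b → Hom (a ∙ b) (b ∙ a)

  cast : ∀ {a a′ b b′} → a ≡ a′ → b ≡ b′ → Hom a b → Hom a′ b′
  cast = subst₂ Hom

-- The law σ a ε ≈ id (up to cast) follows from σ-hexagon and σ-involutive.

record IsSSMC {M : ObjectMonoid} (D : RawSSMC M) : Set where
  open ObjectMonoid M using (_∙_; ε; assoc; identityˡ; identityʳ)
  open RawSSMC D
  field
    isEquivalence : ∀ {a b} → IsEquivalence (_≈_ {a} {b})

    ∘-cong : ∀ {a b c} {g g′ : Hom b c} {f f′ : Hom a b} →
             g ≈ g′ → f ≈ f′ → g ∘ f ≈ g′ ∘ f′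
    ∘-identityˡ : ∀ {a b} (f : Hom a b) → id ∘ f ≈ f
    ∘-identityʳ : ∀ {a b} (f : Hom a b) → f ∘ id ≈ f
    ∘-assoc : ∀ {a b c d} (h : Hom c d) (g : Hom b c) (f : Hom a b) →
              (h ∘ g) ∘ f ≈ h ∘ (g ∘ f)

    ⊠-cong : ∀ {a b c d} {f f′ : Hom a b} {g g′ : Hom c d} →
             f ≈ f′ → g ≈ g′ → f ⊠ g ≈ f′ ⊠ g′
    ⊠-id : ∀ a b → id {a} ⊠ id {b} ≈ id
    ⊠-∘ : ∀ {a b c a′ b′ c′} (g : Hom b c) (f : Hom a b)
          (g′ : Hom b′ c′) (f′ : Hom a′ b′) →
          (g ∘ f) ⊠ (g′ ∘ f′) ≈ (g ⊠ g′) ∘ (f ⊠ f′)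

    ⊠-identityˡ : ∀ {a b} (f : Hom a b) →
                  cast (identityˡ a) (identityˡ b) (id {ε} ⊠ f) ≈ f
    ⊠-identityʳ : ∀ {a b} (f : Hom a b) →
                  cast (identityʳ a) (identityʳ b) (f ⊠ id {ε}) ≈ f
    ⊠-assoc : ∀ {a b c d e k} (f : Hom a b) (g : Hom c d) (h : Hom e k) →
              cast (assoc a c e) (assoc b d k) ((f ⊠ g) ⊠ h) ≈ f ⊠ (g ⊠ h)

    σ-natural : ∀ {a b c d} (f : Hom a b) (g : Hom c d) →
                σ b d ∘ (f ⊠ g) ≈ (g ⊠ f) ∘ σ a c
    σ-involutive : ∀ a b → σ b a ∘ σ a b ≈ id
    σ-hexagon : ∀ a b c → σ a (b ∙ c) ≈
                cast refl (sym (assoc b c a)) (id {b} ⊠ σ a c) ∘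
                cast (assoc a b c) (assoc b a c) (σ a b ⊠ id {c})

  ≈-refl : ∀ {a b} {f : Hom a b} → f ≈ f
  ≈-refl = IsEquivalence.refl isEquivalence

  ≈-sym : ∀ {a b} {f g : Hom a b} → f ≈ g → g ≈ f
  ≈-sym = IsEquivalence.sym isEquivalence

  ≈-trans : ∀ {a b} {f g h : Hom a b} → f ≈ g → g ≈ h → f ≈ h
  ≈-trans = IsEquivalence.trans isEquivalence

record SSMC (M : ObjectMonoid) : Set₁ where
  constructor mkSSMC
  field
    raw    : RawSSMC M
    isSSMC : IsSSMC raw
  open RawSSMC raw public
  open IsSSMC isSSMC public

open SSMC using (raw)

ColoredProp : Set → Set₁
ColoredProp C = SSMC (C *)

MonochromaticProp : Set₁
MonochromaticProp = SSMC ℕ-monoid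

module Heterogeneous {M : ObjectMonoid} (E : SSMC M) where

  open SSMC E

  infix 4 _∼_

  record _∼_ {a b a′ b′} (f : Hom a b) (g : Hom a′ b′) : Set where
    constructor het
    field
      dom≡ : a ≡ a′
      cod≡ : b ≡ b′
      cast≈ : cast dom≡ cod≡ f ≈ g

  ≈⇒∼ : ∀ {a b} {f g : Hom a b} → f ≈ g → f ∼ g
  ≈⇒∼ = het refl refl

  ∼⇒≈ : ∀ {a b} {f g : Hom a b} → f ∼ g → f ≈ g
  ∼⇒≈ (het refl refl f≈g) = f≈g

  ∼-refl : ∀ {a b} {f : Hom a b} → f ∼ f
  ∼-refl = ≈⇒∼ ≈-refl

  ∼-sym : ∀ {a b a′ b′} {f : Hom a b} {g : Hom a′ b′} → f ∼ g → g ∼ f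
  ∼-sym (het refl refl f≈g) = ≈⇒∼ (≈-sym f≈g)

  ∼-trans : ∀ {a b a′ b′ a″ b″}
            {f : Hom a b} {g : Hom a′ b′} {h : Hom a″ b″} →
            f ∼ g → g ∼ h → f ∼ h
  ∼-trans (het refl refl f≈g) (het refl refl g≈h) = ≈⇒∼ (≈-trans f≈g g≈h)

  cast-∼ : ∀ {a b a′ b′} (p : a ≡ a′) (q : b ≡ b′) (f : Hom a b) →
           cast p q f ∼ f
  cast-∼ refl refl f = ∼-refl

  ∘-∼ : ∀ {a b c a′ b′ c′} {g : Hom b c} {g′ : Hom b′ c′}
        {f : Hom a b} {f′ : Hom a′ b′} → g ∼ g′ → f ∼ f′ → g ∘ f ∼ g′ ∘ f′
  ∘-∼ (het refl refl g≈g′) (het refl refl f≈f′) = ≈⇒∼ (∘-cong g≈g′ f≈f′)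

  ⊠-∼ : ∀ {a b c d a′ b′ c′ d′} {f : Hom a b} {f′ : Hom a′ b′}
        {g : Hom c d} {g′ : Hom c′ d′} → f ∼ f′ → g ∼ g′ → f ⊠ g ∼ f′ ⊠ g′
  ⊠-∼ (het refl refl f≈f′) (het refl refl g≈g′) = ≈⇒∼ (⊠-cong f≈f′ g≈g′)

  id-∼ : ∀ {a a′} → a ≡ a′ → id {a} ∼ id {a′}
  id-∼ refl = ∼-refl

  σ-∼ : ∀ {a b a′ b′} → a ≡ a′ → b ≡ b′ → σ a b ∼ σ a′ b′
  σ-∼ refl refl = ∼-refl

-- The action on objects is an index, so that functors to be compared agree on
-- objects by their types and _≈ᶠ_ only concerns morphisms.

record Functor {M N : ObjectMonoid} (φ : Carrier M → Carrier N)
               (D : SSMC M) (E : SSMC N) : Set where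
  private
    module D = SSMC D
    module E = SSMC E
  field
    F₁           : ∀ {a b} → D.Hom a b → E.Hom (φ a) (φ b)
    F-cong       : ∀ {a b} {f g : D.Hom a b} → f D.≈ g → F₁ f E.≈ F₁ g
    identity     : ∀ a → F₁ (D.id {a}) E.≈ E.id
    homomorphism : ∀ {a b c} (g : D.Hom b c) (f : D.Hom a b) →
                   F₁ (g D.∘ f) E.≈ F₁ g E.∘ F₁ f

infix 4 _≈ᶠ_

_≈ᶠ_ : {M N : ObjectMonoid} {φ : Carrier M → Carrier N}
       {D : SSMC M} {E : SSMC N} → Rel (Functor φ D E) 0ℓ
_≈ᶠ_ {D = D} {E} F G =
  ∀ {a b} (f : SSMC.Hom D a b) →
  SSMC._≈_ E (Functor.F₁ F f) (Functor.F₁ G f)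

Faithful : {M N : ObjectMonoid} {φ : Carrier M → Carrier N}
           {D : SSMC M} {E : SSMC N} → Functor φ D E → Set
Faithful {D = D} {E} F =
  ∀ {a b} (f g : SSMC.Hom D a b) →
  SSMC._≈_ E (Functor.F₁ F f) (Functor.F₁ F g) → SSMC._≈_ D f g

infixr 9 _∘ᶠ_

_∘ᶠ_ : {M N P : ObjectMonoid}
       {ψ : Carrier N → Carrier P} {φ : Carrier M → Carrier N}
       {D : SSMC M} {E : SSMC N} {K : SSMC P} →
       Functor ψ E K → Functor φ D E → Functor (ψ ∘′ φ) D K
_∘ᶠ_ {φ = φ} {K = K} G F = record
  { F₁           = λ f → G.F₁ (F.F₁ f)
  ; F-cong       = λ f≈g → G.F-cong (F.F-cong f≈g)
  ; identity     = λ a → K.≈-trans (G.F-cong (F.identity a)) (G.identity (φ a))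
  ; homomorphism = λ g f → K.≈-trans (G.F-cong (F.homomorphism g f))
                                   (G.homomorphism (F.F₁ g) (F.F₁ f))
  }
  where
  module F = Functor F
  module G = Functor G
  module K = SSMC K

record IsStrictMonoidal {M N : ObjectMonoid} {φ : Carrier M → Carrier N}
                        {D : SSMC M} {E : SSMC N}
                        (φ-hom : IsMonoidHom M N φ)
                        (F : Functor φ D E) : Set where
  open Functor F
  private
    module D = SSMC D
    module E = SSMC E
    φ-∙ = homo {M} {N} φ-hom
  field
    ⊠-homo : ∀ {a b c d} (f : D.Hom a b) (g : D.Hom c d) →
             F₁ (f D.⊠ g) E.≈
             E.cast (sym (φ-∙ a c)) (sym (φ-∙ b d)) (F₁ f E.⊠ F₁ g)
    σ-homo : ∀ a b → F₁ (D.σ a b) E.≈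
             E.cast (sym (φ-∙ a b)) (sym (φ-∙ b a)) (E.σ (φ a) (φ b))

record PropMorphism {M : ObjectMonoid} (D E : SSMC M) : Set where
  field
    functor          : Functor (λ a → a) D E
    isStrictMonoidal : IsStrictMonoidal (id-isMonoidHom M) functor

record Signature (M : ObjectMonoid) : Set₁ where
  field
    Gen : Carrier M → Carrier M → Set

open Signature using (Gen)

-- Representatives of diagrams: the morphisms of the free prop are these terms
-- up to the relation _⊢_≈_ below with no equations.

data Diagram {M : ObjectMonoid} (Σ : Signature M) :
             Carrier M → Carrier M → Set where
  gen : ∀ {a b} → Gen Σ a b → Diagram Σ a b
  id  : ∀ {a} → Diagram Σ a a
  _∘_ : ∀ {a b c} → Diagram Σ b c → Diagram Σ a b → Diagram Σ a c
  _⊠_ : ∀ {a b c d} → Diagram Σ a b → Diagram Σ c d →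
        Diagram Σ (ObjectMonoid._∙_ M a c) (ObjectMonoid._∙_ M b d)
  σ   : ∀ a b → Diagram Σ (ObjectMonoid._∙_ M a b) (ObjectMonoid._∙_ M b a)

infixr 9 _∘_
infixr 7 _⊠_

Equations : {M : ObjectMonoid} → Signature M → Set₁
Equations Σ = ∀ {a b} → Diagram Σ a b → Diagram Σ a b → Set

-- The smallest congruence containing the laws of a symmetric strict monoidal
-- category and the given equations.

infix 4 _⊢_≈_

data _⊢_≈_ {M : ObjectMonoid} {Σ : Signature M} (Eqs : Equations Σ) :
           ∀ {a b} → Diagram Σ a b → Diagram Σ a b → Set where
  axiom : ∀ {a b} {f g : Diagram Σ a b} → Eqs f g → Eqs ⊢ f ≈ g

  ≈-refl  : ∀ {a b} {f : Diagram Σ a b} → Eqs ⊢ f ≈ f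
  ≈-sym   : ∀ {a b} {f g : Diagram Σ a b} → Eqs ⊢ f ≈ g → Eqs ⊢ g ≈ f
  ≈-trans : ∀ {a b} {f g h : Diagram Σ a b} →
            Eqs ⊢ f ≈ g → Eqs ⊢ g ≈ h → Eqs ⊢ f ≈ h

  ∘-cong : ∀ {a b c} {g g′ : Diagram Σ b c} {f f′ : Diagram Σ a b} →
           Eqs ⊢ g ≈ g′ → Eqs ⊢ f ≈ f′ → Eqs ⊢ g ∘ f ≈ g′ ∘ f′
  ∘-identityˡ : ∀ {a b} (f : Diagram Σ a b) → Eqs ⊢ id ∘ f ≈ f
  ∘-identityʳ : ∀ {a b} (f : Diagram Σ a b) → Eqs ⊢ f ∘ id ≈ f
  ∘-assoc : ∀ {a b c d}
            (h : Diagram Σ c d) (g : Diagram Σ b c) (f : Diagram Σ a b) →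
            Eqs ⊢ (h ∘ g) ∘ f ≈ h ∘ (g ∘ f)

  ⊠-cong : ∀ {a b c d} {f f′ : Diagram Σ a b} {g g′ : Diagram Σ c d} →
           Eqs ⊢ f ≈ f′ → Eqs ⊢ g ≈ g′ → Eqs ⊢ f ⊠ g ≈ f′ ⊠ g′
  ⊠-id : ∀ a b → Eqs ⊢ id {a = a} ⊠ id {a = b} ≈ id
  ⊠-∘ : ∀ {a b c a′ b′ c′} (g : Diagram Σ b c) (f : Diagram Σ a b)
        (g′ : Diagram Σ b′ c′) (f′ : Diagram Σ a′ b′) →
        Eqs ⊢ (g ∘ f) ⊠ (g′ ∘ f′) ≈ (g ⊠ g′) ∘ (f ⊠ f′)

  ⊠-identityˡ : ∀ {a b} (f : Diagram Σ a b) →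
                Eqs ⊢ subst₂ (Diagram Σ)
                        (ObjectMonoid.identityˡ M a) (ObjectMonoid.identityˡ M b)
                        (id {a = ObjectMonoid.ε M} ⊠ f)
                    ≈ f
  ⊠-identityʳ : ∀ {a b} (f : Diagram Σ a b) →
                Eqs ⊢ subst₂ (Diagram Σ)
                        (ObjectMonoid.identityʳ M a) (ObjectMonoid.identityʳ M b)
                        (f ⊠ id {a = ObjectMonoid.ε M})
                    ≈ f
  ⊠-assoc : ∀ {a b c d e k}
            (f : Diagram Σ a b) (g : Diagram Σ c d) (h : Diagram Σ e k) →
            Eqs ⊢ subst₂ (Diagram Σ)
                    (ObjectMonoid.assoc M a c e) (ObjectMonoid.assoc M b d k)
                    ((f ⊠ g) ⊠ h)
                ≈ f ⊠ (g ⊠ h)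

  σ-natural : ∀ {a b c d} (f : Diagram Σ a b) (g : Diagram Σ c d) →
              Eqs ⊢ σ b d ∘ (f ⊠ g) ≈ (g ⊠ f) ∘ σ a c
  σ-involutive : ∀ a b → Eqs ⊢ σ b a ∘ σ a b ≈ id
  σ-hexagon : ∀ a b c →
              Eqs ⊢ σ a (ObjectMonoid._∙_ M b c)
                  ≈ subst₂ (Diagram Σ) refl (sym (ObjectMonoid.assoc M b c a))
                      (id {a = b} ⊠ σ a c) ∘
                    subst₂ (Diagram Σ)
                      (ObjectMonoid.assoc M a b c) (ObjectMonoid.assoc M b a c)
                      (σ a b ⊠ id {a = c})

record GraphicalLanguage (M : ObjectMonoid) : Set₁ where
  field
    signature : Signature M
    equations : Equations signature

quotient : {M : ObjectMonoid} (Σ : Signature M) → Equations Σ → SSMC M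
quotient Σ Eqs = record
  { raw = record
    { Hom = Diagram Σ
    ; _≈_ = λ f g → Eqs ⊢ f ≈ g
    ; id  = id
    ; _∘_ = _∘_
    ; _⊠_ = _⊠_
    ; σ   = σ
    }
  ; isSSMC = record
    { isEquivalence = record { refl = ≈-refl ; sym = ≈-sym ; trans = ≈-trans }
    ; ∘-cong        = ∘-cong
    ; ∘-identityˡ   = ∘-identityˡ
    ; ∘-identityʳ   = ∘-identityʳ
    ; ∘-assoc       = ∘-assoc
    ; ⊠-cong        = ⊠-cong
    ; ⊠-id          = ⊠-id
    ; ⊠-∘           = ⊠-∘
    ; ⊠-identityˡ   = ⊠-identityˡ
    ; ⊠-identityʳ   = ⊠-identityʳ
    ; ⊠-assoc       = ⊠-assoc
    ; σ-natural     = σ-natural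
    ; σ-involutive  = σ-involutive
    ; σ-hexagon     = σ-hexagon
    }
  }

FreeProp : {M : ObjectMonoid} → Signature M → SSMC M
FreeProp Σ = quotient Σ (λ _ _ → ⊥)

underlying : {M : ObjectMonoid} → GraphicalLanguage M → SSMC M
underlying 𝓛 = quotient signature equations
  where open GraphicalLanguage 𝓛

-- Interpretations in general are symmetric monoidal functors.  Those with a
-- prop on the same colors as target are taken to be prop morphisms: the wire
-- stripper is strict, full and surjective on objects, so an equation
-- [_] ∘ G = I ∘ {_} with G a prop morphism forces I to be one too.

Interpretation : {M : ObjectMonoid} → GraphicalLanguage M → SSMC M → Set
Interpretation 𝓛 C = PropMorphism (underlying 𝓛) C

module Evaluation
  {M N : ObjectMonoid} {Σ : Signature M}
  {φ : Carrier M → Carrier N} (φ-hom : IsMonoidHom M N φ)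
  (E : RawSSMC N) (ρ : ∀ {a b} → Gen Σ a b → RawSSMC.Hom E (φ a) (φ b)) where

  private
    module E = RawSSMC E
    φ-∙ = homo {M} {N} φ-hom

  eval : ∀ {a b} → Diagram Σ a b → E.Hom (φ a) (φ b)
  eval (gen x) = ρ x
  eval id      = E.id
  eval (g ∘ f) = eval g E.∘ eval f
  eval (_⊠_ {a} {b} {c} {d} f g) =
    E.cast (sym (φ-∙ a c)) (sym (φ-∙ b d)) (eval f E.⊠ eval g)
  eval (σ a b) = E.cast (sym (φ-∙ a b)) (sym (φ-∙ b a)) (E.σ (φ a) (φ b))

module EvaluationSound
  {M N : ObjectMonoid} {Σ : Signature M}
  {φ : Carrier M → Carrier N} (φ-hom : IsMonoidHom M N φ)
  (E : SSMC N) (ρ : ∀ {a b} → Gen Σ a b → SSMC.Hom E (φ a) (φ b)) where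

  private
    module M = ObjectMonoid M
    module E = SSMC E
    φ-∙ = homo {M} {N} φ-hom
    φ-ε = ε-homo {M} {N} φ-hom
  open Evaluation {M} {N} {Σ} φ-hom (raw E) ρ
  open Heterogeneous E

  eval-subst : ∀ {a b a′ b′} (p : a ≡ a′) (q : b ≡ b′) (f : Diagram Σ a b) →
               eval (subst₂ (Diagram Σ) p q f) ∼ eval f
  eval-subst refl refl f = ∼-refl

  eval-⊠ : ∀ {a b c d} (f : Diagram Σ a b) (g : Diagram Σ c d) →
           eval (f ⊠ g) ∼ eval f E.⊠ eval g
  eval-⊠ f g = cast-∼ _ _ _

  eval-σ : ∀ a b → eval (σ a b) ∼ E.σ (φ a) (φ b)
  eval-σ a b = cast-∼ _ _ _

  eval-cong : (Eqs : Equations Σ) →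
              (∀ {a b} {f g : Diagram Σ a b} → Eqs f g → eval f E.≈ eval g) →
              ∀ {a b} {f g : Diagram Σ a b} → Eqs ⊢ f ≈ g → eval f E.≈ eval g
  eval-cong Eqs sound = go
    where
    go : ∀ {a b} {f g : Diagram Σ a b} → Eqs ⊢ f ≈ g → eval f E.≈ eval g
    go (axiom f≈g)       = sound f≈g
    go ≈-refl            = E.≈-refl
    go (≈-sym p)         = E.≈-sym (go p)
    go (≈-trans p q)     = E.≈-trans (go p) (go q)
    go (∘-cong p q)      = E.∘-cong (go p) (go q)
    go (∘-identityˡ f)   = E.∘-identityˡ (eval f)
    go (∘-identityʳ f)   = E.∘-identityʳ (eval f)
    go (∘-assoc h g f)   = E.∘-assoc (eval h) (eval g) (eval f)
    go (⊠-cong {f = f} {f′} {g} {g′} p q) = ∼⇒≈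
      (∼-trans (eval-⊠ f g)
      (∼-trans (⊠-∼ (≈⇒∼ (go p)) (≈⇒∼ (go q)))
               (∼-sym (eval-⊠ f′ g′))))
    go (⊠-id a b) = ∼⇒≈
      (∼-trans (eval-⊠ (id {a = a}) (id {a = b}))
      (∼-trans (≈⇒∼ (E.⊠-id (φ a) (φ b)))
               (id-∼ (sym (φ-∙ a b)))))
    go (⊠-∘ g f g′ f′) = ∼⇒≈
      (∼-trans (eval-⊠ (g ∘ f) (g′ ∘ f′))
      (∼-trans (≈⇒∼ (E.⊠-∘ (eval g) (eval f) (eval g′) (eval f′)))
               (∘-∼ (∼-sym (eval-⊠ g g′)) (∼-sym (eval-⊠ f f′)))))
    go (⊠-identityˡ f) = ∼⇒≈
      (∼-trans (eval-subst (M.identityˡ _) (M.identityˡ _) (id {a = M.ε} ⊠ f))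
      (∼-trans (eval-⊠ (id {a = M.ε}) f)
      (∼-trans (⊠-∼ (id-∼ φ-ε) ∼-refl)
               (het _ _ (E.⊠-identityˡ (eval f))))))
    go (⊠-identityʳ f) = ∼⇒≈
      (∼-trans (eval-subst (M.identityʳ _) (M.identityʳ _) (f ⊠ id {a = M.ε}))
      (∼-trans (eval-⊠ f (id {a = M.ε}))
      (∼-trans (⊠-∼ ∼-refl (id-∼ φ-ε))
               (het _ _ (E.⊠-identityʳ (eval f))))))
    go (⊠-assoc f g h) = ∼⇒≈
      (∼-trans (eval-subst (M.assoc _ _ _) (M.assoc _ _ _) ((f ⊠ g) ⊠ h))
      (∼-trans (eval-⊠ (f ⊠ g) h)
      (∼-trans (⊠-∼ (eval-⊠ f g) ∼-refl)
      (∼-trans (het _ _ (E.⊠-assoc (eval f) (eval g) (eval h)))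
      (∼-trans (⊠-∼ ∼-refl (∼-sym (eval-⊠ g h)))
               (∼-sym (eval-⊠ f (g ⊠ h))))))))
    go (σ-natural {a} {b} {c} {d} f g) = ∼⇒≈
      (∼-trans (∘-∼ (eval-σ b d) (eval-⊠ f g))
      (∼-trans (≈⇒∼ (E.σ-natural (eval f) (eval g)))
               (∘-∼ (∼-sym (eval-⊠ g f)) (∼-sym (eval-σ a c)))))
    go (σ-involutive a b) = ∼⇒≈
      (∼-trans (∘-∼ (eval-σ b a) (eval-σ a b))
      (∼-trans (≈⇒∼ (E.σ-involutive (φ a) (φ b)))
               (id-∼ (sym (φ-∙ a b)))))
    go (σ-hexagon a b c) = ∼⇒≈
      (∼-trans (eval-σ a (b M.∙ c))
      (∼-trans (σ-∼ refl (φ-∙ b c))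
      (∼-trans (≈⇒∼ (E.σ-hexagon (φ a) (φ b) (φ c)))
               (∘-∼ right left))))
      where
      right = ∼-trans (cast-∼ _ _ (E.id {φ b} E.⊠ E.σ (φ a) (φ c)))
             (∼-trans (⊠-∼ ∼-refl (∼-sym (eval-σ a c)))
             (∼-trans (∼-sym (eval-⊠ (id {a = b}) (σ a c)))
                      (∼-sym (eval-subst refl (sym (M.assoc b c a))
                                (id {a = b} ⊠ σ a c)))))
      left  = ∼-trans (cast-∼ _ _ (E.σ (φ a) (φ b) E.⊠ E.id {φ c}))
             (∼-trans (⊠-∼ (∼-sym (eval-σ a b)) ∼-refl)
             (∼-trans (∼-sym (eval-⊠ (σ a b) (id {a = c})))
                      (∼-sym (eval-subst (M.assoc a b c) (M.assoc b a c)
                                (σ a b ⊠ id {a = c})))))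

  module _ (Eqs : Equations Σ)
    (sound : ∀ {a b} {f g : Diagram Σ a b} → Eqs f g → eval f E.≈ eval g)
    where

    evalFunctor : Functor φ (quotient Σ Eqs) E
    evalFunctor = record
      { F₁           = eval
      ; F-cong       = eval-cong Eqs sound
      ; identity     = λ _ → E.≈-refl
      ; homomorphism = λ _ _ → E.≈-refl
      }

    evalFunctor-isStrictMonoidal : IsStrictMonoidal φ-hom evalFunctor
    evalFunctor-isStrictMonoidal = record
      { ⊠-homo = λ _ _ → E.≈-refl
      ; σ-homo = λ _ _ → E.≈-refl
      }

record ℕ₊ : Set where
  constructor pos
  field
    value       : ℕ
    .{{nonZero}} : NonZero value

open ℕ₊ using (value)

1₊ : ℕ₊
1₊ = pos 1

suc₊ : ℕ₊ → ℕ₊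
suc₊ n = pos (suc (value n))

infix 8 _·_

_·_ : ℕ → ℕ₊ → List ℕ₊
k · n = replicate k n

globalSize : List ℕ₊ → ℕ
globalSize a = sum (map value a)

globalSize-++ : ∀ a b → globalSize (a ++ b) ≡ globalSize a + globalSize b
globalSize-++ a b =
  trans (cong sum (map-++ value a b)) (sum-++ (map value a) (map value b))

globalSize-isMonoidHom : IsMonoidHom (ℕ₊ *) ℕ-monoid globalSize
globalSize-isMonoidHom = record
  { isMagmaHomomorphism = record
    { isRelHomomorphism = record { cong = cong globalSize }
    ; homo              = globalSize-++
    }
  ; ε-homo = refl
  }

·1-+ : ∀ k l → (k + l) · 1₊ ≡ k · 1₊ ++ l · 1₊
·1-+ zero    l = refl
·1-+ (suc k) l = cong (1₊ ∷_) (·1-+ k l)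

·1-isMonoidHom : IsMonoidHom ℕ-monoid (ℕ₊ *) (_· 1₊)
·1-isMonoidHom = record
  { isMagmaHomomorphism = record
    { isRelHomomorphism = record { cong = cong (_· 1₊) }
    ; homo              = ·1-+
    }
  ; ε-homo = refl
  }

globalSize-·1 : ∀ k → globalSize (k · 1₊) ≡ k
globalSize-·1 zero    = refl
globalSize-·1 (suc k) = cong suc (globalSize-·1 k)

module _ (𝓛 : GraphicalLanguage ℕ-monoid) where

  open GraphicalLanguage 𝓛

  data ScalableGen : List ℕ₊ → List ℕ₊ → Set where
    δ    : ∀ n → ScalableGen (1 · suc₊ n) (1 · 1₊ ++ 1 · n)
    γ    : ∀ n → ScalableGen (1 · 1₊ ++ 1 · n) (1 · suc₊ n)
    base : ∀ {n m} → Gen signature n m → ScalableGen (n · 1₊) (m · 1₊)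

  ScalableSig : Signature (ℕ₊ *)
  ScalableSig = record { Gen = ScalableGen }

  -- A diagram of 𝓛 read on wires of size 1.

  onUnitWires : ∀ {n m} → Diagram signature n m →
                Diagram ScalableSig (n · 1₊) (m · 1₊)
  onUnitWires = Evaluation.eval
    ·1-isMonoidHom (raw (FreeProp ScalableSig)) (λ x → gen (base x))

  data ScalableEq : Equations ScalableSig where
    γ∘δ  : ∀ n → ScalableEq (gen (γ n) ∘ gen (δ n)) id
    δ∘γ  : ∀ n → ScalableEq (gen (δ n) ∘ gen (γ n))
                            (id {a = 1 · 1₊} ⊠ id {a = 1 · n})
    base : ∀ {n m} {f g : Diagram signature n m} →
           equations f g → ScalableEq (onUnitWires f) (onUnitWires g)

  Scalable : GraphicalLanguage (ℕ₊ *)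
  Scalable = record { signature = ScalableSig ; equations = ScalableEq }

  private
    L = underlying 𝓛
    module L = SSMC L

  stripGen : ∀ {a b} → ScalableGen a b → L.Hom (globalSize a) (globalSize b)
  stripGen (δ n) = id
  stripGen (γ n) = id
  stripGen (base {n} {m} x) =
    L.cast (sym (globalSize-·1 n)) (sym (globalSize-·1 m)) (gen x)

  open Evaluation {Σ = ScalableSig}
    globalSize-isMonoidHom (raw L) stripGen public
    using () renaming (eval to strip)
  private
    module Sound = EvaluationSound {Σ = ScalableSig}
      globalSize-isMonoidHom L stripGen
  open Heterogeneous L

  strip-onUnitWires : ∀ {n m} (f : Diagram signature n m) →
                      strip (onUnitWires f) ∼ f
  strip-onUnitWires (gen x) = cast-∼ _ _ (gen x)
  strip-onUnitWires (id {n}) = id-∼ (globalSize-·1 n)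
  strip-onUnitWires (g ∘ f) = ∘-∼ (strip-onUnitWires g) (strip-onUnitWires f)
  strip-onUnitWires (_⊠_ {n} {m} {k} {l} f g) =
    ∼-trans (Sound.eval-subst (sym (·1-+ n k)) (sym (·1-+ m l))
              (onUnitWires f ⊠ onUnitWires g))
    (∼-trans (Sound.eval-⊠ (onUnitWires f) (onUnitWires g))
             (⊠-∼ (strip-onUnitWires f) (strip-onUnitWires g)))
  strip-onUnitWires (σ n m) =
    ∼-trans (Sound.eval-subst (sym (·1-+ n m)) (sym (·1-+ m n))
              (σ (n · 1₊) (m · 1₊)))
    (∼-trans (Sound.eval-σ (n · 1₊) (m · 1₊))
             (σ-∼ (globalSize-·1 n) (globalSize-·1 m)))

  strip-sound : ∀ {a b} {f g : Diagram ScalableSig a b} →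
                ScalableEq f g → strip f L.≈ strip g
  strip-sound (γ∘δ n) = L.∘-identityˡ id
  strip-sound (δ∘γ n) = ∼⇒≈
    (∼-trans (≈⇒∼ (L.∘-identityˡ id))
    (∼-trans (≈⇒∼ (L.≈-sym (L.⊠-id (globalSize (1 · 1₊)) (globalSize (1 · n)))))
             (∼-sym (cast-∼ _ _ _))))
  strip-sound (base {f = f} {g} f≈g) = ∼⇒≈
    (∼-trans (strip-onUnitWires f)
    (∼-trans (≈⇒∼ (axiom f≈g))
             (∼-sym (strip-onUnitWires g))))

  wireStripper : Functor globalSize (underlying Scalable) L
  wireStripper = Sound.evalFunctor ScalableEq strip-sound

  wireStripper-isStrictMonoidal :
    IsStrictMonoidal globalSize-isMonoidHom wireStripper
  wireStripper-isStrictMonoidal =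
    Sound.evalFunctor-isStrictMonoidal ScalableEq strip-sound

-- An object (n , pₙ) is given by the list pₙ alone, as n = globalSize pₙ.
-- The casts identify the size of a concatenation with the sum of the sizes.

Partitioned : MonochromaticProp → RawSSMC (ℕ₊ *)
Partitioned C = record
  { Hom = λ p q → C.Hom (globalSize p) (globalSize q)
  ; _≈_ = C._≈_
  ; id  = C.id
  ; _∘_ = C._∘_
  ; _⊠_ = λ {p} {q} {r} {s} f g →
          C.cast (sym (globalSize-++ p r)) (sym (globalSize-++ q s)) (f C.⊠ g)
  ; σ   = λ p q → C.cast (sym (globalSize-++ p q)) (sym (globalSize-++ q p))
                         (C.σ (globalSize p) (globalSize q))
  }
  where module C = SSMC C

forgetPartition : (C : MonochromaticProp) (isProp : IsSSMC (Partitioned C)) →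
                  Functor globalSize (mkSSMC (Partitioned C) isProp) C
forgetPartition C isProp = record
  { F₁           = λ f → f
  ; F-cong       = λ f≈g → f≈g
  ; identity     = λ _ → C.≈-refl
  ; homomorphism = λ _ _ → C.≈-refl
  }
  where module C = SSMC C

{-# OPTIONS --safe #-}

-- The scaled interpretation is forced to be ⟦_⟧ ∘ {_}, because [_] is the
-- identity on morphisms.  The faithfulness claim rests on the faithfulness of
-- the wire stripper: the dividers split every object a into [a] unit wires, by
-- split a : a → [a]·1, and split is natural from the identity to "strip, then
-- read on unit wires".  Since split a is left invertible (by gatherers), a
-- diagram can be recovered, up to ≈, from its stripped version.

module Submission where

open import Data.List.Base using ([]; _∷_; _++_)
open import Data.List.Properties using (++-assoc; ++-identityʳ)
open import Data.Nat.Base using (zero; suc; NonZero)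
open import Data.Nat.Properties using (+-assoc)
open import Data.Product.Base using (Σ-syntax; _×_; _,_; ∃-syntax)
open import Function.Bundles using (_⇔_; mk⇔)
open import Relation.Binary.PropositionalEquality
  using (_≡_; refl; sym; cong₂; subst₂)
open import Defs
open PropMorphism using (functor)

-- Functors and equality of morphisms up to equality of objects.

module _ {M N : ObjectMonoid} {φ : ObjectMonoid.Carrier M → ObjectMonoid.Carrier N}
         {D : SSMC M} {E : SSMC N} (F : Functor φ D E) where
  private
    module D = Heterogeneous D
    module E = Heterogeneous E

  F-∼ : ∀ {a b a′ b′} {f : SSMC.Hom D a b} {g : SSMC.Hom D a′ b′} →
        f D.∼ g → Functor.F₁ F f E.∼ Functor.F₁ F g
  F-∼ (D.het refl refl f≈g) = E.≈⇒∼ (Functor.F-cong F f≈g)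

  module _ (φ-hom : IsMonoidHom M N φ) (strict : IsStrictMonoidal φ-hom F) where

    F-⊠ : ∀ {a b c d} (f : SSMC.Hom D a b) (g : SSMC.Hom D c d) →
          Functor.F₁ F (SSMC._⊠_ D f g) E.∼
          SSMC._⊠_ E (Functor.F₁ F f) (Functor.F₁ F g)
    F-⊠ f g = E.∼-trans (E.≈⇒∼ (IsStrictMonoidal.⊠-homo strict f g))
                        (E.cast-∼ _ _ _)

    F-σ : ∀ a b → Functor.F₁ F (SSMC.σ D a b) E.∼ SSMC.σ E (φ a) (φ b)
    F-σ a b = E.∼-trans (E.≈⇒∼ (IsStrictMonoidal.σ-homo strict a b))
                        (E.cast-∼ _ _ _)

-- Cast-free monoidal laws and split monomorphisms.

module _ {M : ObjectMonoid} (E : SSMC M) where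
  open Heterogeneous E
  private
    module M = ObjectMonoid M
    module E = SSMC E

  ⊠-identityˡ-∼ : ∀ {a b} (f : E.Hom a b) → E.id {M.ε} E.⊠ f ∼ f
  ⊠-identityˡ-∼ f = het _ _ (E.⊠-identityˡ f)

  ⊠-identityʳ-∼ : ∀ {a b} (f : E.Hom a b) → f E.⊠ E.id {M.ε} ∼ f
  ⊠-identityʳ-∼ f = het _ _ (E.⊠-identityʳ f)

  ⊠-assoc-∼ : ∀ {a b c d e k} (f : E.Hom a b) (g : E.Hom c d) (h : E.Hom e k) →
              (f E.⊠ g) E.⊠ h ∼ f E.⊠ (g E.⊠ h)
  ⊠-assoc-∼ f g h = het _ _ (E.⊠-assoc f g h)

  -- Split monomorphisms, which are left cancellable and closed under both composition and tensor.
  -- This is the form in which "dividers are undone by gatherers" gets used.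
  HasRetraction : ∀ {a b} → E.Hom a b → Set
  HasRetraction {a} {b} s = ∃[ r ] (r E.∘ s E.≈ E.id {a})

  id-hasRetraction : ∀ {a} → HasRetraction (E.id {a})
  id-hasRetraction = E.id , E.∘-identityˡ E.id

  cast-hasRetraction : ∀ {a b b′} (q : b ≡ b′) {s : E.Hom a b} →
                       HasRetraction s → HasRetraction (E.cast refl q s)
  cast-hasRetraction refl h = h

  ∘-hasRetraction : ∀ {a b c} {t : E.Hom b c} {s : E.Hom a b} →
                    HasRetraction t → HasRetraction s → HasRetraction (t E.∘ s)
  ∘-hasRetraction {t = t} {s} (u , ut≈id) (r , rs≈id) = r E.∘ u ,
    E.≈-trans (E.∘-assoc r u (t E.∘ s))
    (E.≈-trans (E.∘-cong E.≈-refl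
                 (E.≈-trans (E.≈-sym (E.∘-assoc u t s))
                 (E.≈-trans (E.∘-cong ut≈id E.≈-refl) (E.∘-identityˡ s))))
               rs≈id)

  ⊠-hasRetraction : ∀ {a b c d} {s : E.Hom a b} {t : E.Hom c d} →
                    HasRetraction s → HasRetraction t → HasRetraction (s E.⊠ t)
  ⊠-hasRetraction {a} {c = c} {s = s} {t} (r , rs≈id) (u , ut≈id) = r E.⊠ u ,
    E.≈-trans (E.≈-sym (E.⊠-∘ r s u t))
    (E.≈-trans (E.⊠-cong rs≈id ut≈id) (E.⊠-id a c))

  retraction-cancelˡ : ∀ {a b c} {s : E.Hom b c} → HasRetraction s →
                       {f g : E.Hom a b} → s E.∘ f E.≈ s E.∘ g → f E.≈ g
  retraction-cancelˡ {s = s} (r , rs≈id) {f} {g} sf≈sg =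
    E.≈-trans (E.≈-sym (undo f)) (E.≈-trans (E.∘-cong E.≈-refl sf≈sg) (undo g))
    where
    undo : ∀ h → r E.∘ (s E.∘ h) E.≈ h
    undo h = E.≈-trans (E.≈-sym (E.∘-assoc r s h))
             (E.≈-trans (E.∘-cong rs≈id E.≈-refl) (E.∘-identityˡ h))

-- The partitioned category is a colored prop.

module _ (C : MonochromaticProp) where
  private module C = SSMC C
  open Heterogeneous C

  -- Casts here run along equalities of lists, those of `C` along equalities of sizes. Comparing
  -- everything by `∼` in `C` erases both kinds.
  Partitioned-cast-∼ : ∀ {p q p′ q′} (e : p ≡ p′) (e′ : q ≡ q′)
                       (f : RawSSMC.Hom (Partitioned C) p q) →
                       RawSSMC.cast (Partitioned C) e e′ f ∼ f
  Partitioned-cast-∼ refl refl f = ∼-refl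

  Partitioned-⊠-∼ : ∀ {p q r s} (f : RawSSMC.Hom (Partitioned C) p q)
                    (g : RawSSMC.Hom (Partitioned C) r s) →
                    RawSSMC._⊠_ (Partitioned C) {p} {q} {r} {s} f g ∼ f C.⊠ g
  Partitioned-⊠-∼ f g = cast-∼ _ _ (f C.⊠ g)

  Partitioned-σ-∼ : ∀ p q → RawSSMC.σ (Partitioned C) p q ∼
                    C.σ (globalSize p) (globalSize q)
  Partitioned-σ-∼ p q = cast-∼ _ _ (C.σ (globalSize p) (globalSize q))

  -- Each law is the same law of `C` at the global sizes, once the casts built into `⊠` and `σ` are
  -- erased by `∼`.
  Partitioned-isSSMC : IsSSMC (Partitioned C)
  Partitioned-isSSMC = record
    { isEquivalence = C.isEquivalence
    ; ∘-cong        = C.∘-cong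
    ; ∘-identityˡ   = C.∘-identityˡ
    ; ∘-identityʳ   = C.∘-identityʳ
    ; ∘-assoc       = C.∘-assoc
    -- The lists are passed explicitly from here on: a morphism only determines the sizes of its
    -- ends, not their partitions.
    ; ⊠-cong        = λ {a} {b} {c} {d} {f} {f′} {g} {g′} f≈f′ g≈g′ → ∼⇒≈
        (∼-trans (⊠∼ {a} {b} {c} {d} f g)
        (∼-trans (⊠-∼ (≈⇒∼ f≈f′) (≈⇒∼ g≈g′))
                 (∼-sym (⊠∼ {a} {b} {c} {d} f′ g′))))
    ; ⊠-id          = λ a b → ∼⇒≈
        (∼-trans (⊠∼ {a} {a} {b} {b} C.id C.id)
        (∼-trans (≈⇒∼ (C.⊠-id (globalSize a) (globalSize b)))
                 (id-∼ (sym (globalSize-++ a b)))))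
    ; ⊠-∘           = λ {a} {b} {c} {a′} {b′} {c′} g f g′ f′ → ∼⇒≈
        (∼-trans (⊠∼ {a} {c} {a′} {c′} (g C.∘ f) (g′ C.∘ f′))
        (∼-trans (≈⇒∼ (C.⊠-∘ g f g′ f′))
                 (∘-∼ (∼-sym (⊠∼ {b} {c} {b′} {c′} g g′))
                      (∼-sym (⊠∼ {a} {b} {a′} {b′} f f′)))))
    -- `[] ++ a` reduces to `a`, so unlike in the right unit law there is no outer cast to remove.
    ; ⊠-identityˡ   = λ {a} {b} f → ∼⇒≈
        (∼-trans (⊠∼ {[]} {[]} {a} {b} C.id f) (⊠-identityˡ-∼ C f))
    ; ⊠-identityʳ   = λ {a} {b} f → ∼⇒≈
        (∼-trans (Partitioned-cast-∼ (++-identityʳ a) (++-identityʳ b) _)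
        (∼-trans (⊠∼ {a} {b} {[]} {[]} f C.id) (⊠-identityʳ-∼ C f)))
    ; ⊠-assoc       = λ {a} {b} {c} {d} {e} {k} f g h → ∼⇒≈
        (∼-trans (Partitioned-cast-∼ (++-assoc a c e) (++-assoc b d k) _)
        (∼-trans (⊠∼ {a ++ c} {b ++ d} {e} {k} _ h)
        (∼-trans (⊠-∼ (⊠∼ {a} {b} {c} {d} f g) ∼-refl)
        (∼-trans (⊠-assoc-∼ C f g h)
        (∼-trans (⊠-∼ ∼-refl (∼-sym (⊠∼ {c} {d} {e} {k} g h)))
                 (∼-sym (⊠∼ {a} {b} {c ++ e} {d ++ k} f _)))))))
    ; σ-natural     = λ {a} {b} {c} {d} f g → ∼⇒≈
        (∼-trans (∘-∼ (Partitioned-σ-∼ b d) (⊠∼ {a} {b} {c} {d} f g))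
        (∼-trans (≈⇒∼ (C.σ-natural f g))
                 (∘-∼ (∼-sym (⊠∼ {c} {d} {a} {b} g f))
                      (∼-sym (Partitioned-σ-∼ a c)))))
    ; σ-involutive  = λ a b → ∼⇒≈
        (∼-trans (∘-∼ (Partitioned-σ-∼ b a) (Partitioned-σ-∼ a b))
        (∼-trans (≈⇒∼ (C.σ-involutive (globalSize a) (globalSize b)))
                 (id-∼ (sym (globalSize-++ a b)))))
    ; σ-hexagon     = λ a b c → ∼⇒≈
        (∼-trans (Partitioned-σ-∼ a (b ++ c))
        (∼-trans (σ-∼ refl (globalSize-++ b c))
        (∼-trans (≈⇒∼ (C.σ-hexagon (globalSize a) (globalSize b) (globalSize c)))
                 (∘-∼ (id⊠σ a b c) (σ⊠id a b c)))))
    }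
    where
    ⊠∼ = λ {p q r s} → Partitioned-⊠-∼ {p} {q} {r} {s}
    module P = RawSSMC (Partitioned C)

    id⊠σ : ∀ a b c →
           C.cast refl
             (sym (+-assoc (globalSize b) (globalSize c) (globalSize a)))
             (C.id {globalSize b} C.⊠ C.σ (globalSize a) (globalSize c)) ∼
           P.cast refl (sym (++-assoc b c a))
             (P._⊠_ {b} {b} {a ++ c} {c ++ a} (P.id {b}) (P.σ a c))
    id⊠σ a b c =
      ∼-trans (cast-∼ refl _ _)
      (∼-trans (⊠-∼ ∼-refl (∼-sym (Partitioned-σ-∼ a c)))
      (∼-trans (∼-sym (⊠∼ {b} {b} {a ++ c} {c ++ a} C.id (P.σ a c)))
               (∼-sym (Partitioned-cast-∼ refl (sym (++-assoc b c a)) _))))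

    σ⊠id : ∀ a b c →
           C.cast (+-assoc (globalSize a) (globalSize b) (globalSize c))
                  (+-assoc (globalSize b) (globalSize a) (globalSize c))
                  (C.σ (globalSize a) (globalSize b) C.⊠ C.id {globalSize c}) ∼
           P.cast (++-assoc a b c) (++-assoc b a c)
             (P._⊠_ {a ++ b} {b ++ a} {c} {c} (P.σ a b) (P.id {c}))
    σ⊠id a b c =
      ∼-trans (cast-∼ _ _ _)
      (∼-trans (⊠-∼ (∼-sym (Partitioned-σ-∼ a b)) ∼-refl)
      (∼-trans (∼-sym (⊠∼ {a ++ b} {b ++ a} {c} {c} (P.σ a b) C.id))
               (∼-sym (Partitioned-cast-∼ (++-assoc a b c) (++-assoc b a c) _))))

-- Reading diagrams on unit wires, as a functor opposite to the wire stripper.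

module _ (𝓛 : GraphicalLanguage ℕ-monoid) where

  open GraphicalLanguage 𝓛
  private
    S = underlying (Scalable 𝓛)
    module S = SSMC S
    module LH = Heterogeneous (underlying 𝓛)
    module U = EvaluationSound {Σ = signature}
      ·1-isMonoidHom S (λ x → gen (base x))
    open Evaluation {Σ = signature}
      ·1-isMonoidHom S.raw (λ x → gen (base x)) using ()
      renaming (eval to unit)
  open Heterogeneous S

  -- onUnitWires evaluates in the free prop and unit in its quotient, whose
  -- morphisms have the same representatives.
  onUnitWires≡unit : ∀ {n m} (f : Diagram signature n m) →
                     onUnitWires 𝓛 f ≡ unit f
  onUnitWires≡unit (gen x) = refl
  onUnitWires≡unit id      = refl
  onUnitWires≡unit (g ∘ f) =
    cong₂ _∘_ (onUnitWires≡unit g) (onUnitWires≡unit f)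
  onUnitWires≡unit (_⊠_ {a} {b} {c} {d} f g) =
    cong₂ (λ f g → S.cast (sym (·1-+ a c)) (sym (·1-+ b d)) (f ⊠ g))
          (onUnitWires≡unit f) (onUnitWires≡unit g)
  onUnitWires≡unit (σ n m) = refl

  unit-sound : ∀ {n m} {f g : Diagram signature n m} →
               equations f g → unit f S.≈ unit g
  unit-sound {f = f} {g} f≈g =
    subst₂ S._≈_ (onUnitWires≡unit f) (onUnitWires≡unit g) (axiom (base f≈g))

  unitFunctor : Functor (_· 1₊) (underlying 𝓛) S
  unitFunctor = U.evalFunctor equations unit-sound

  strip-⊠ : ∀ {a b c d} (f : S.Hom a b) (g : S.Hom c d) →
            strip 𝓛 (f ⊠ g) LH.∼ strip 𝓛 f ⊠ strip 𝓛 g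
  strip-⊠ = F-⊠ (wireStripper 𝓛)
    globalSize-isMonoidHom (wireStripper-isStrictMonoidal 𝓛)

  strip-σ : ∀ a b → strip 𝓛 (σ a b) LH.∼ σ (globalSize a) (globalSize b)
  strip-σ = F-σ (wireStripper 𝓛)
    globalSize-isMonoidHom (wireStripper-isStrictMonoidal 𝓛)

  -- Splitting every object into unit wires.

  splitWire : ∀ k .{{_ : NonZero k}} → S.Hom (1 · pos k) (k · 1₊)
  splitWire 1             = id
  splitWire (suc (suc k)) =
    (id {a = 1 · 1₊} ⊠ splitWire (suc k)) ∘ gen (δ (pos (suc k)))

  split : ∀ a → S.Hom a (globalSize a · 1₊)
  split []          = id
  split (pos k ∷ a) =
    S.cast refl (sym (·1-+ k (globalSize a))) (splitWire k ⊠ split a)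

  splitWire-hasRetraction : ∀ k .{{_ : NonZero k}} → HasRetraction S (splitWire k)
  splitWire-hasRetraction 1             = id-hasRetraction S
  splitWire-hasRetraction (suc (suc k)) =
    ∘-hasRetraction S
      (⊠-hasRetraction S (id-hasRetraction S) (splitWire-hasRetraction (suc k)))
      (gen (γ _) , axiom (γ∘δ _))

  split-hasRetraction : ∀ a → HasRetraction S (split a)
  split-hasRetraction []          = id-hasRetraction S
  split-hasRetraction (pos k ∷ a) =
    cast-hasRetraction S (sym (·1-+ k (globalSize a)))
      (⊠-hasRetraction S (splitWire-hasRetraction k) (split-hasRetraction a))

  split-∷ : ∀ k .{{_ : NonZero k}} a →
            split (pos k ∷ a) ∼ splitWire k ⊠ split a
  split-∷ k a = cast-∼ _ _ _

  split-[_] : ∀ k .{{_ : NonZero k}} → split (1 · pos k) ∼ splitWire k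
  split-[ k ] = ∼-trans (split-∷ k []) (⊠-identityʳ-∼ S (splitWire k))

  split-++ : ∀ a b → split (a ++ b) ∼ split a ⊠ split b
  split-++ []          b = ∼-sym (⊠-identityˡ-∼ S (split b))
  split-++ (pos k ∷ a) b =
    ∼-trans (split-∷ k (a ++ b))
    (∼-trans (⊠-∼ ∼-refl (split-++ a b))
    (∼-trans (∼-sym (⊠-assoc-∼ S (splitWire k) (split a) (split b)))
             (⊠-∼ (∼-sym (split-∷ k a)) ∼-refl)))

  -- No divider is used on wires of size 1. This settles the generators of `𝓛` in `split-natural`,
  -- whose ends consist of such wires.
  split-·1 : ∀ n → split (n · 1₊) ∼ id {a = n · 1₊}
  split-·1 zero    = ∼-refl
  split-·1 (suc n) =
    ∼-trans (split-∷ 1 (n · 1₊))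
    (∼-trans (⊠-∼ ∼-refl (split-·1 n)) (≈⇒∼ (⊠-id (1 · 1₊) (n · 1₊))))

  -- Splitting a wire of size at least 2 starts with a divider by the recursion of `splitWire`; what
  -- follows splits the two wires that it produces.
  split∘δ : ∀ n → split (1 · 1₊ ++ 1 · n) ∘ gen (δ n) ∼ split (1 · suc₊ n)
  split∘δ (pos zero {{()}})
  split∘δ (pos (suc k)) =
    ∼-trans (∘-∼ (∼-trans (split-∷ 1 _) (⊠-∼ ∼-refl split-[ suc k ])) ∼-refl)
            (∼-sym split-[ suc (suc k) ])

  -- Induction on the diagram. Dividers and gatherers are stripped to identities, so for them the
  -- square says that `split` absorbs them; composites paste squares, and tensors and symmetries
  -- reduce to `split-++`.
  split-natural : ∀ {a b} (f : S.Hom a b) →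
                  split b ∘ f ∼ unit (strip 𝓛 f) ∘ split a
  split-natural (gen (δ n)) =
    ∼-trans (split∘δ n) (∼-sym (≈⇒∼ (∘-identityˡ _)))
  -- Unfolding the split of the target by `split∘δ` puts a divider right after the gatherer, and the
  -- two cancel.
  split-natural (gen (γ n)) =
    ∼-trans (∘-∼ (∼-sym (split∘δ n)) ∼-refl)
    (∼-trans (≈⇒∼ (∘-assoc _ _ _))
    (∼-trans (∘-∼ ∼-refl
               (∼-trans (≈⇒∼ (axiom (δ∘γ n))) (≈⇒∼ (⊠-id (1 · 1₊) (1 · n)))))
    (∼-trans (≈⇒∼ (∘-identityʳ _)) (∼-sym (≈⇒∼ (∘-identityˡ _))))))
  -- Both splittings are identities, and stripping `x` and reading it on unit wires gives `x` back
  -- up to casts.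
  split-natural (gen (base {n} {m} x)) =
    ∼-trans (∘-∼ (split-·1 m) ∼-refl)
    (∼-trans (≈⇒∼ (∘-identityˡ _))
    (∼-trans (∼-sym (≈⇒∼ (∘-identityʳ _)))
             (∘-∼ (∼-sym (F-∼ unitFunctor
                         (LH.cast-∼ (sym (globalSize-·1 n))
                                    (sym (globalSize-·1 m)) (gen x))))
                  (∼-sym (split-·1 n)))))
  split-natural id =
    ∼-trans (≈⇒∼ (∘-identityʳ _)) (∼-sym (≈⇒∼ (∘-identityˡ _)))
  split-natural (g ∘ f) =
    ∼-trans (∼-sym (≈⇒∼ (∘-assoc _ g f)))
    (∼-trans (∘-∼ (split-natural g) ∼-refl)
    (∼-trans (≈⇒∼ (∘-assoc _ _ f))
    (∼-trans (∘-∼ ∼-refl (split-natural f))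
             (∼-sym (≈⇒∼ (∘-assoc _ _ _))))))
  split-natural (_⊠_ {a} {b} {c} {d} f g) =
    ∼-trans (∘-∼ (split-++ b d) ∼-refl)
    (∼-trans (∼-sym (≈⇒∼ (⊠-∘ _ f _ g)))
    (∼-trans (⊠-∼ (split-natural f) (split-natural g))
    (∼-trans (≈⇒∼ (⊠-∘ _ _ _ _))
             (∘-∼ (∼-sym (∼-trans (F-∼ unitFunctor (strip-⊠ f g))
                                  (U.eval-⊠ (strip 𝓛 f) (strip 𝓛 g))))
                  (∼-sym (split-++ a c))))))
  split-natural (σ a b) =
    ∼-trans (∘-∼ (split-++ b a) ∼-refl)
    (∼-trans (∼-sym (≈⇒∼ (σ-natural (split a) (split b))))
             (∘-∼ (∼-sym (∼-trans (F-∼ unitFunctor (strip-σ a b))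
                                  (U.eval-σ (globalSize a) (globalSize b))))
                  (∼-sym (split-++ a b))))

  -- By naturality, postcomposing `f` and `g` with the splitting of their codomain gives equal
  -- results; that splitting is then cancelled.
  wireStripper-faithful : Faithful (wireStripper 𝓛)
  wireStripper-faithful f g f≈g = retraction-cancelˡ S (split-hasRetraction _)
    (∼⇒≈ (∼-trans (split-natural f)
         (∼-trans (∘-∼ (≈⇒∼ (Functor.F-cong unitFunctor f≈g)) ∼-refl)
                  (∼-sym (split-natural g)))))

  -- The scaled interpretation and its faithfulness.

  module _ (C : MonochromaticProp) (I : Interpretation 𝓛 C) where
    private
      module CH = Heterogeneous C
      I-strict = PropMorphism.isStrictMonoidal I
      composite = functor I ∘ᶠ wireStripper 𝓛

    scaledInterpretation :
      PropMorphism S (mkSSMC (Partitioned C) (Partitioned-isSSMC C))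
    scaledInterpretation = record
      -- The fields of the composite are reused as they are: the hom-sets of `Partitioned C` are
      -- those of `C` at the global sizes.
      { functor = record { Functor composite }
      ; isStrictMonoidal = record
        { ⊠-homo = λ f g → CH.∼⇒≈
            (CH.∼-trans (F-∼ (functor I) (strip-⊠ f g))
            (CH.∼-trans (F-⊠ (functor I) (id-isMonoidHom ℕ-monoid) I-strict
                             (strip 𝓛 f) (strip 𝓛 g))
                        (CH.∼-sym (CH.cast-∼ _ _ _))))
        ; σ-homo = λ a b → CH.∼⇒≈
            (CH.∼-trans (F-∼ (functor I) (strip-σ a b))
            (CH.∼-trans (F-σ (functor I) (id-isMonoidHom ℕ-monoid) I-strict _ _)
                        (CH.∼-sym (CH.cast-∼ _ _ _))))
        }
      }

    -- Every diagram of `𝓛` is, up to casts, the stripped version of its reading on unit wires, so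
    -- equalities between such diagrams can be tested there.
    scaledInterpretation-faithful⁻¹ :
      Faithful (functor scaledInterpretation) → Faithful (functor I)
    scaledInterpretation-faithful⁻¹ faithful f g If≈Ig = LH.∼⇒≈
      (LH.∼-trans (LH.∼-sym (strip-onUnitWires 𝓛 f))
      (LH.∼-trans (LH.≈⇒∼ (Functor.F-cong (wireStripper 𝓛) unit≈))
                  (strip-onUnitWires 𝓛 g)))
      where
      unit≈ : onUnitWires 𝓛 f S.≈ onUnitWires 𝓛 g
      unit≈ = faithful (onUnitWires 𝓛 f) (onUnitWires 𝓛 g) (CH.∼⇒≈
        (CH.∼-trans (F-∼ (functor I) (strip-onUnitWires 𝓛 f))
        (CH.∼-trans (CH.≈⇒∼ If≈Ig)
                    (CH.∼-sym (F-∼ (functor I) (strip-onUnitWires 𝓛 g))))))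

lemma7 : (𝓛 : GraphicalLanguage ℕ-monoid) (C : MonochromaticProp)
    (I : Interpretation 𝓛 C) →
    Σ[ isProp ∈ IsSSMC (Partitioned C) ]
    Σ[ Iₚ ∈ PropMorphism (underlying (Scalable 𝓛)) (mkSSMC (Partitioned C) isProp) ]
    (forgetPartition C isProp ∘ᶠ functor Iₚ ≈ᶠ functor I ∘ᶠ wireStripper 𝓛)
    × ((J : PropMorphism (underlying (Scalable 𝓛)) (mkSSMC (Partitioned C) isProp)) →
    forgetPartition C isProp ∘ᶠ functor J ≈ᶠ functor I ∘ᶠ wireStripper 𝓛 →
    functor J ≈ᶠ functor Iₚ)
    × (Faithful (functor Iₚ) ⇔ Faithful (functor I))
lemma7 𝓛 C I =
    Partitioned-isSSMC C
  , scaledInterpretation 𝓛 C I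
  , (λ _ → SSMC.≈-refl C)
  -- Forgetting the partition fixes every morphism, so the hypothesis on `J` already is the
  -- conclusion.
  , (λ _ J≈ → J≈)
  , mk⇔ (scaledInterpretation-faithful⁻¹ 𝓛 C I)
        -- On morphisms the scaled interpretation is `I` after the wire stripper, a composite of
        -- faithful functors.
        (λ faithful f g p →
           wireStripper-faithful 𝓛 f g
             (faithful (strip 𝓛 f) (strip 𝓛 g) p))
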